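{- The quadrangle inequality fails for optimal 2WCST costs: there exist an instance with keys $1,2,\dots,n$ and indices $i\le i'\le j\le j'$ such that $$C_{i,j}+C_{i',j'}\ >\ C_{i,j'}+C_{i',j}.$$
   Context: An instance consists of keys $1,2,\dots,n$ (with the usual order), key $k$ having weight $w_k\ge 0$. For a nonempty set of keys, a two-way comparison search tree (2WCST) is a rooted binary decision tree whose leaves are in bijection with these keys and in which each internal node is labelled either with an equal-to test $\langle =k\rangle$ ("is $q=k$?") or a less-than test $\langle <k\rangle$ ("is $q<k$?") for a key $k$, and has two children, one for "yes" and one for "no". It is required that for each key $q$ in the set, the search for $q$ starting at the root ends in the leaf labelled $q$. Its cost is $\sum_k w_k\cdot\mathrm{depth}(k)$ over the keys in the set, where $\mathrm{depth}(k)$ is the number of comparison nodes on the path from the root to leaf $k$. For $1\le i\le j\le n$, $C_{i,j}$ denotes the minimum cost of a 2WCST for the set of keys $\{i,i+1,\dots,j\}$ (so $C_{i,i}=0$). -}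

module Defs where

open import Algebra.Definitions.RawMonoid using (sum)
open import Data.Bool using (Bool; if_then_else_; _∧_)
open import Data.Fin using (Fin; _≤?_; _<?_; _≟_)
open import Data.Fin.Subset using (Subset; _∈_)
open import Data.Integer using (+_)
open import Data.List using (List; [_]; _++_)
import Data.List.Membership.Propositional as List
open import Data.List.Relation.Unary.Unique.Propositional using (Unique)
open import Data.Nat using (ℕ; zero; suc)
open import Data.Product using (_×_; ∃-syntax)
open import Data.Rational using (ℚ; 0ℚ; _≤_; _*_; _/_; +-0-rawMonoid)
open import Data.Vec using (tabulate; lookup)
open import Function.Bundles using (_⇔_)
open import Relation.Binary.PropositionalEquality using (_≡_)
open import Relation.Nullary.Decidable using (does)

-- The keys 1, …, n are represented by Fin n, with its usual order.

data Test (n : ℕ) : Set where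
  equalTo  : Fin n → Test n
  lessThan : Fin n → Test n

answer : ∀ {n} → Test n → Fin n → Bool
answer (equalTo k)  q = does (q ≟ k)
answer (lessThan k) q = does (q <? k)

-- In node t yes no, the second argument is the "yes" child.
data Tree (n : ℕ) : Set where
  leaf : Fin n → Tree n
  node : Test n → Tree n → Tree n → Tree n

leaves : ∀ {n} → Tree n → List (Fin n)
leaves (leaf k)        = [ k ]
leaves (node _ yes no) = leaves yes ++ leaves no

-- The label of the leaf in which the search for a key ends.
search : ∀ {n} → Tree n → Fin n → Fin n
search (leaf k)        q = k
search (node t yes no) q = if answer t q then search yes q else search no q

-- The number of comparisons made by the search for q.  In a 2WCST for a set
-- containing q, this search ends in the only leaf labelled q, so this is the
-- number of comparison nodes on the path from the root to leaf q.
depth : ∀ {n} → Tree n → Fin n → ℕ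
depth (leaf _)        q = zero
depth (node t yes no) q = suc (if answer t q then depth yes q else depth no q)

-- The first two fields say that labelling is a bijection from the leaves of T
-- to S.
record Is2WCST {n : ℕ} (S : Subset n) (T : Tree n) : Set where
  field
    leaves-unique  : Unique (leaves T)
    leaves-keys    : ∀ k → (k List.∈ leaves T) ⇔ (k ∈ S)
    search-correct : ∀ q → q ∈ S → search T q ≡ q

cost : ∀ {n} → (Fin n → ℚ) → Subset n → Tree n → ℚ
cost w S T =
  sum +-0-rawMonoid
    (λ k → if lookup S k then w k * (+ depth T k / 1) else 0ℚ)

IsMinCost : ∀ {n} → (Fin n → ℚ) → Subset n → ℚ → Set
IsMinCost w S c =
  (∃[ T ] (Is2WCST S T × cost w S T ≡ c)) ×
  (∀ T → Is2WCST S T → c ≤ cost w S T)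

interval : ∀ {n} → Fin n → Fin n → Subset n
interval i j = tabulate (λ k → does (i ≤? k) ∧ does (k ≤? j))

-- C[ w , i , j ]≡ c  states that C_{i,j} = c for the weights w.
C[_,_,_]≡_ : ∀ {n} → (Fin n → ℚ) → Fin n → Fin n → ℚ → Set
C[ w , i , j ]≡ c = IsMinCost w (interval i j) c

{-# OPTIONS --safe #-}
-- Take three keys of weights 0, 1, 0.  Every search tree for a set that
-- contains the middle key and another key makes at least one comparison for the
-- middle key, so C₁₂, C₂₃ ≥ 1.  Asking first whether q is the middle key shows
-- that one comparison suffices even for all three keys, so C₁₃ = 1, whereas
-- C₂₂ = 0.
module Submission where

open import Defs
open import Data.Nat using (ℕ)
open import Data.Fin using (Fin; _≤_)
open import Data.Product using (_×_; ∃-syntax; Σ-syntax)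
open import Data.Rational using (ℚ; 0ℚ; _+_; _>_) renaming (_≤_ to _≤ℚ_)

open import Data.Bool using (true; false; if_then_else_)
open import Data.Fin using (_≟_)
open import Data.Fin.Properties using (all?)
open import Data.Fin.Patterns using (0F; 1F; 2F)
open import Data.Fin.Subset using (Subset; _∈_)
open import Data.Fin.Subset.Properties using (_∈?_)
open import Data.Integer using (+_; +≤+)
import Data.Integer.Properties as ℤ
import Data.List.Membership.DecPropositional as DecMembership
import Data.List.Relation.Unary.Unique.DecPropositional as DecUnique
open import Data.Nat using (z≤n; s≤s) renaming (_≤_ to _≤ℕ_)
open import Data.Product using (_,_; uncurry)
open import Data.Rational using (1ℚ; toℚᵘ; _*_; _/_) renaming (_≤?_ to _≤ℚ?_; _<?_ to _<ℚ?_)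
import Data.Rational.Properties as ℚ
open import Data.Rational.Unnormalised using (mkℚᵘ; *≤*)
import Data.Rational.Unnormalised.Properties as ℚᵘ
open import Data.Unit using (tt)
open import Data.Vec using (lookup)
open import Data.Vec.Properties using ([]=⇒lookup; lookup⇒[]=)
open import Function.Bundles using (_⇔_; mk⇔; Equivalence)
open import Relation.Binary.PropositionalEquality
  using (_≡_; _≢_; refl; sym; trans; cong; cong₂; subst; module ≡-Reasoning)
open import Relation.Nullary using (Dec; contradiction)
open import Relation.Nullary.Decidable using (map′; from-yes; toWitness; _×-dec_; _→-dec_)

_⇔-dec_ : ∀ {a b} {A : Set a} {B : Set b} → Dec A → Dec B → Dec (A ⇔ B)
a? ⇔-dec b? = map′ (uncurry mk⇔) (λ e → Equivalence.to e , Equivalence.from e)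
                   ((a? →-dec b?) ×-dec (b? →-dec a?))

-- With finitely many keys each field is a finite check, so the explicit trees below are verified by
-- evaluation.
is2WCST? : ∀ {n} (S : Subset n) (T : Tree n) → Dec (Is2WCST S T)
is2WCST? S T =
  map′ (λ (u , l , s) → record
         { leaves-unique = u ; leaves-keys = l ; search-correct = s })
       (λ t → let open Is2WCST t in leaves-unique , leaves-keys , search-correct)
       (unique? (leaves T)
         ×-dec all? (λ k → (k ∈ᴸ? leaves T) ⇔-dec (k ∈? S))
         ×-dec all? (λ q → (q ∈? S) →-dec (search T q ≟ q)))
  where
  open DecUnique _≟_ using (unique?)
  open DecMembership _≟_ using () renaming (_∈?_ to _∈ᴸ?_)

-- A lone leaf gives every search the same answer, so it cannot be correct for both `p` and `q`; any
-- other tree makes a comparison at its root.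
1≤depth : ∀ {n} {S : Subset n} {T} → Is2WCST S T →
          ∀ {p q} → p ∈ S → q ∈ S → p ≢ q → 1 ≤ℕ depth T p
1≤depth {T = leaf _} t p∈S q∈S p≢q =
  contradiction (trans (sym (search-correct _ p∈S)) (search-correct _ q∈S)) p≢q
  where open Is2WCST t
1≤depth {T = node _ _ _} _ _ _ _ = s≤s z≤n

/1-mono-≤ : ∀ {m n} → m ≤ℕ n → (+ m / 1) ≤ℚ (+ n / 1)
-- For variable `m` and `n` the reduction to lowest terms in `_/_` does not compute, so the
-- comparison is made between unnormalised fractions with denominator 1.
/1-mono-≤ {m} {n} m≤n = ℚ.toℚᵘ-cancel-≤ (begin
  toℚᵘ (+ m / 1)  ≃⟨ ℚ.toℚᵘ-fromℚᵘ (mkℚᵘ (+ m) 0) ⟩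
  mkℚᵘ (+ m) 0    ≤⟨ *≤* (ℤ.*-monoʳ-≤-nonNeg (+ 1) (+≤+ m≤n)) ⟩
  mkℚᵘ (+ n) 0    ≃⟨ ℚ.toℚᵘ-fromℚᵘ (mkℚᵘ (+ n) 0) ⟨
  toℚᵘ (+ n / 1)  ∎)
  where open ℚᵘ.≤-Reasoning

weight : Fin 3 → ℚ
weight 0F = 0ℚ
weight 1F = 1ℚ
weight 2F = 0ℚ

-- The outer keys contribute zero whether or not they lie in `S`: outside by the default value of
-- the summand, inside by their weight.
cost-weight : ∀ S T → 1F ∈ S → cost weight S T ≡ + depth T 1F / 1
cost-weight S T 1∈S = begin
  term 0F + (term 1F + (term 2F + 0ℚ))
    ≡⟨ cong₂ (λ x y → x + (term 1F + (y + 0ℚ)))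
             (weightless 0F refl) (weightless 2F refl) ⟩
  0ℚ + (term 1F + 0ℚ)
    ≡⟨ trans (ℚ.+-identityˡ _) (ℚ.+-identityʳ _) ⟩
  term 1F
    ≡⟨ cong (if_then 1ℚ * (+ depth T 1F / 1) else 0ℚ) ([]=⇒lookup 1∈S) ⟩
  1ℚ * (+ depth T 1F / 1)
    ≡⟨ ℚ.*-identityˡ _ ⟩
  + depth T 1F / 1 ∎
  where
  open ≡-Reasoning

  term : Fin 3 → ℚ
  term k = if lookup S k then weight k * (+ depth T k / 1) else 0ℚ

  weightless : ∀ k → weight k ≡ 0ℚ → term k ≡ 0ℚ
  weightless k wₖ≡0 with lookup S k
  ... | true  = trans (cong (_* (+ depth T k / 1)) wₖ≡0) (ℚ.*-zeroˡ (+ depth T k / 1))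
  ... | false = refl

-- By `cost-weight`, minimising the rational cost amounts to minimising a natural number, the depth
-- of the middle key.
isMinCost : ∀ {S T m} → 1F ∈ S → Is2WCST S T → depth T 1F ≡ m →
            (∀ T′ → Is2WCST S T′ → m ≤ℕ depth T′ 1F) →
            IsMinCost weight S (+ m / 1)
isMinCost {S} {T} 1∈S t refl least =
  (T , t , cost-weight S T 1∈S) ,
  λ T′ t′ → subst (_ ≤ℚ_) (sym (cost-weight S T′ 1∈S)) (/1-mono-≤ (least T′ t′))

-- The key `q` serves only to rule out a lone leaf, which gives the lower bound through `1≤depth`.
isMinCost-1 : ∀ {S T q} → 1F ∈ S → q ∈ S → 1F ≢ q →
              Is2WCST S T → depth T 1F ≡ 1 → IsMinCost weight S 1ℚ
isMinCost-1 1∈S q∈S 1≢q t d≡1 =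
  isMinCost 1∈S t d≡1 λ _ t′ → 1≤depth t′ 1∈S q∈S 1≢q

C₁₂ : C[ weight , 0F , 1F ]≡ 1ℚ
C₁₂ = isMinCost-1 {q = 0F} (lookup⇒[]= _ _ refl) (lookup⇒[]= _ _ refl) (λ ())
  (toWitness {a? = is2WCST? (interval 0F 1F) (node (equalTo 1F) (leaf 1F) (leaf 0F))} tt) refl

C₂₃ : C[ weight , 1F , 2F ]≡ 1ℚ
C₂₃ = isMinCost-1 {q = 2F} (lookup⇒[]= _ _ refl) (lookup⇒[]= _ _ refl) (λ ())
  (toWitness {a? = is2WCST? (interval 1F 2F) (node (equalTo 1F) (leaf 1F) (leaf 2F))} tt) refl

C₁₃ : C[ weight , 0F , 2F ]≡ 1ℚ
C₁₃ = isMinCost-1 {q = 0F} (lookup⇒[]= _ _ refl) (lookup⇒[]= _ _ refl) (λ ())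
  (toWitness {a? = is2WCST? (interval 0F 2F)
    -- The second test separates the outer keys; their depth of 2 is free because they weigh
    -- nothing.
    (node (equalTo 1F) (leaf 1F) (node (lessThan 1F) (leaf 0F) (leaf 2F)))} tt) refl

C₂₂ : C[ weight , 1F , 1F ]≡ 0ℚ
C₂₂ = isMinCost (lookup⇒[]= _ _ refl)
  (toWitness {a? = is2WCST? (interval 1F 1F) (leaf 1F)} tt) refl (λ _ _ → z≤n)

mainTheorem6 : Σ[ n ∈ ℕ ] Σ[ w ∈ (Fin n → ℚ) ]
    ((∀ k → 0ℚ ≤ℚ w k) ×
    (Σ[ i ∈ Fin n ] Σ[ i′ ∈ Fin n ] Σ[ j ∈ Fin n ] Σ[ j′ ∈ Fin n ]
    (i ≤ i′ × i′ ≤ j × j ≤ j′ ×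
    (∃[ cᵢⱼ ] ∃[ cᵢ′ⱼ′ ] ∃[ cᵢⱼ′ ] ∃[ cᵢ′ⱼ ]
    (C[ w , i  , j  ]≡ cᵢⱼ   ×
    C[ w , i′ , j′ ]≡ cᵢ′ⱼ′ ×
    C[ w , i  , j′ ]≡ cᵢⱼ′  ×
    C[ w , i′ , j  ]≡ cᵢ′ⱼ  ×
    cᵢⱼ + cᵢ′ⱼ′ > cᵢⱼ′ + cᵢ′ⱼ)))))
mainTheorem6 =
  3 , weight , from-yes (all? λ k → 0ℚ ≤ℚ? weight k) ,
  -- Taking `i′` and `j` equal shrinks the inner interval to the middle key alone, so the two sums
  -- to compare are 1 + 1 and 1 + 0.
  0F , 1F , 1F , 2F , z≤n , s≤s z≤n , s≤s z≤n ,
  1ℚ , 1ℚ , 1ℚ , 0ℚ , C₁₂ , C₂₃ , C₁₃ , C₂₂ ,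
  from-yes (1ℚ + 0ℚ <ℚ? 1ℚ + 1ℚ)
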